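{- There exists a maximum class of VC-dimension $3$ that has no corner. (That is, there exist a finite set $X$ and a concept class $C\subseteq 2^{X}$ which is maximum, has VC-dimension $3$, and contains no corner.)
   Context: Let $X$ be a finite set with $n=|X|$. A concept class is a family $C\subseteq 2^X$ of subsets of $X$ (concepts). For $Y\subseteq X$ let $C|Y=\{c\cap Y: c\in C\}$. A set $Y\subseteq X$ is shattered by $C$ if $C|Y=2^Y$. The VC-dimension of $C$ is the largest size $d$ of a set shattered by $C$. $C$ is maximum if $|C|=\sum_{i=0}^{d}\binom{n}{i}$, where $d$ is the VC-dimension of $C$. A cube of $2^X$ is a set of the form $B=\{T\cup Z: Z\subseteq Y\}$ with $Y\subseteq X$ and $T\subseteq X\setminus Y$; $Y$ is its support. A cube of $C$ is a cube $B$ of $2^X$ with $B\subseteq C$. A concept $c\in C$ is a corner of $C$ if $c$ belongs to exactly one inclusion-maximal cube of $C$. -}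

module Defs where

open import Level using (0ℓ)
open import Data.Nat.Base using (ℕ; suc; _≤_)
open import Data.Nat.Combinatorics using () renaming (_C_ to _choose_)
open import Data.Fin.Subset using (Subset; _∩_; _∪_; ∁; ∣_∣) renaming (_⊆_ to _⊆ˢ_)
open import Data.List.Base using (List; length; map; upTo)
open import Data.Nat.ListAction using (sum)
import Data.List.Membership.Propositional as List
open import Data.List.Relation.Unary.Unique.Propositional using (Unique)
open import Data.Product using (∃; ∃!; _×_)
open import Relation.Binary.PropositionalEquality using (_≡_)
open import Relation.Unary using (Pred; _∈_; _⊆_; _≐_)

-- The ground set X is Fin n.  `_⊆ˢ_` is inclusion of subsets of X, while `_∈_`,
-- `_⊆_` and `_≐_` (extensional equality) concern families of subsets of X,
-- viewed as predicates on Subset n.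

Family : ℕ → Set₁
Family n = Pred (Subset n) 0ℓ

-- A duplicate-free list, so that the cardinality of the class is the length.
record ConceptClass (n : ℕ) : Set where
  field
    concepts : List (Subset n)
    unique   : Unique concepts

  ⟦_⟧ : Family n
  ⟦_⟧ c = c List.∈ concepts

  size : ℕ
  size = length concepts

open ConceptClass public using (⟦_⟧; size)

powerset : {n : ℕ} → Subset n → Family n
powerset Y Z = Z ⊆ˢ Y

infix 8 _↾_
_↾_ : {n : ℕ} → ConceptClass n → Subset n → Family n
(C ↾ Y) Z = ∃ λ c → c ∈ ⟦ C ⟧ × Z ≡ c ∩ Y

Shatters : {n : ℕ} → ConceptClass n → Subset n → Set
Shatters C Y = C ↾ Y ≐ powerset Y

-- The empty class shatters nothing, hence has no VC-dimension.
HasVCDim : {n : ℕ} → ConceptClass n → ℕ → Set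
HasVCDim C d =
  (∃ λ Y → Shatters C Y × ∣ Y ∣ ≡ d) × (∀ Y → Shatters C Y → ∣ Y ∣ ≤ d)

IsMaximum : {n : ℕ} → ConceptClass n → Set
IsMaximum {n} C =
  ∃ λ d → HasVCDim C d × size C ≡ sum (map (n choose_) (upTo (suc d)))

record Cube (n : ℕ) : Set where
  field
    support  : Subset n
    tag      : Subset n
    disjoint : tag ⊆ˢ ∁ support

  vertices : Family n
  vertices S = ∃ λ Z → Z ⊆ˢ support × S ≡ tag ∪ Z

open Cube public using (vertices)

infix 4 _≈ᶜ_
_≈ᶜ_ : {n : ℕ} → Cube n → Cube n → Set
B ≈ᶜ B′ = vertices B ≐ vertices B′

IsCubeOf : {n : ℕ} → ConceptClass n → Cube n → Set
IsCubeOf C B = vertices B ⊆ ⟦ C ⟧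

IsMaximalCubeOf : {n : ℕ} → ConceptClass n → Cube n → Set
IsMaximalCubeOf C B =
  IsCubeOf C B × (∀ B′ → IsCubeOf C B′ → vertices B ⊆ vertices B′ → B ≈ᶜ B′)

IsCorner : {n : ℕ} → ConceptClass n → Subset n → Set
IsCorner C c =
  c ∈ ⟦ C ⟧ × ∃! _≈ᶜ_ (λ B → IsMaximalCubeOf C B × c ∈ vertices B)

{-# OPTIONS --safe #-}

-- The support of a cube of a class is shattered by the class, and a cube is
-- determined by its support and any of its vertices.  Hence in a class of
-- VC-dimension d every cube with a support of size d is maximal, and a concept
-- lying in two such cubes is not a corner.  A class of 299 concepts on twelve
-- points is exhibited which shatters no set of size 4 and each of whose concepts
-- lies in at least two 3-cubes.

module Submission where

open import Data.Bool.Base using (Bool; true; false; T; _∧_; _∨_)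
open import Data.Bool.ListAction using (any)
open import Data.Bool.Properties using (T-∧; T-∨)
open import Data.Empty using (⊥-elim)
open import Data.Fin.Subset using (Subset; Side; inside; outside; _∩_; _∪_; ∁; ∣_∣)
  renaming (_∈_ to _∈ˢ_; _∉_ to _∉ˢ_; _⊆_ to _⊆ˢ_; ⊥ to ∅ˢ; ⊤ to Xˢ)
open import Data.Fin.Subset.Properties
open import Data.List.Base using (List; []; _∷_; _++_; map; concatMap; foldr; length)
open import Data.List.Membership.Propositional using (_∈_)
open import Data.List.Membership.Propositional.Properties
  using (∈-map⁺; ∈-map⁻; ∈-++⁺ˡ; ∈-++⁺ʳ; ∈-++⁻)
open import Data.List.Relation.Unary.All as All using (All; []; _∷_; all?)
import Data.List.Relation.Unary.All.Properties as All
open import Data.List.Relation.Unary.AllPairs using ([]; _∷_)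
open import Data.List.Relation.Unary.Any using (here; there)
open import Data.List.Relation.Unary.Any.Properties using (any⁻)
open import Data.List.Relation.Unary.Unique.Propositional using (Unique)
import Data.List.Relation.Unary.Unique.Propositional.Properties as Unique
open import Data.Nat.Base using (ℕ; zero; suc; _+_; _*_; _/_; _%_; _≤_; _<_; _≡ᵇ_;
  z≤n; s≤s; s≤s⁻¹)
open import Data.Nat.Properties using (_≤?_; <⇒≱)
open import Data.Product using (∃; ∃₂; _×_; _,_; proj₁; proj₂)
open import Data.Sum.Base using (_⊎_; inj₁; inj₂; [_,_]′)
open import Data.Vec.Base using ([]; _∷_; here)
open import Data.Vec.Properties using (∷-injectiveʳ)
open import Function.Base using (_∘_; id; _$_)
open import Function.Bundles using (Equivalence)
open import Relation.Binary.PropositionalEquality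
  using (_≡_; _≢_; refl; sym; trans; cong; subst; module ≡-Reasoning)
open import Relation.Nullary using (¬_; yes; no; contradiction)
open import Relation.Nullary.Decidable using (toWitness)
open import Defs

private variable
  n d k : ℕ

-- Cubes

⊆∧∣≥∣⇒≡ : {p q : Subset n} → p ⊆ˢ q → ∣ q ∣ ≤ ∣ p ∣ → p ≡ q
⊆∧∣≥∣⇒≡ {p = p} {q} p⊆q ∣q∣≤∣p∣ = ⊆-antisym p⊆q q⊆p
  where
  q⊆p : q ⊆ˢ p
  q⊆p {x} x∈q with x ∈? p
  ... | yes x∈p = x∈p
  ... | no  x∉p = contradiction ∣q∣≤∣p∣ (<⇒≱ (p⊂q⇒∣p∣<∣q∣ (p⊆q , x , x∈q , x∉p)))

module _ (B : Cube n) where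
  open Cube B hiding (vertices)

  tag∉support : ∀ {x} → x ∈ˢ tag → x ∉ˢ support
  tag∉support = x∈∁p⇒x∉p ∘ disjoint

  tag-vertex : vertices B tag
  tag-vertex = ∅ˢ , ⊆-min support , sym (∪-identityʳ tag)

  vertex∩support : ∀ {Z} → Z ⊆ˢ support → Z ≡ (tag ∪ Z) ∩ support
  vertex∩support {Z} Z⊆Y = ⊆-antisym
    (λ x∈Z → x∈p∩q⁺ (x∈p∪q⁺ (inj₂ x∈Z) , Z⊆Y x∈Z))
    (λ x∈ → let x∈tag∪Z , x∈Y = x∈p∩q⁻ _ _ x∈ in
      [ (λ x∈tag → contradiction x∈Y (tag∉support x∈tag)) , id ]′ (x∈p∪q⁻ _ _ x∈tag∪Z))

  cube⇒shatters : (C : ConceptClass n) → IsCubeOf C B → Shatters C support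
  cube⇒shatters C B⊆C =
    (λ { (c , _ , refl) → p∩q⊆q c support }) ,
    (λ {Z} Z⊆Y → tag ∪ Z , B⊆C (Z , Z⊆Y , refl) , vertex∩support Z⊆Y)

-- The bottom vertex `tag` and the top vertex `tag ∪ support` of `B` differ exactly on its support,
-- while all vertices of `B′` agree off the support of `B′`.
vertices-⊆⇒support-⊆ : (B B′ : Cube n) → (∀ {c} → vertices B c → vertices B′ c) →
                       Cube.support B ⊆ˢ Cube.support B′
vertices-⊆⇒support-⊆ B B′ B⊆B′ {x} x∈Y
  with B⊆B′ (tag-vertex B) | B⊆B′ (Cube.support B , ⊆-refl , refl)
... | Z , _ , tag≡ | Z′ , Z′⊆Y′ , top≡ =
  [ (λ x∈tag′ → contradiction x∈Y
      (tag∉support B (subst (x ∈ˢ_) (sym tag≡) (x∈p∪q⁺ (inj₁ x∈tag′)))))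
  , Z′⊆Y′
  ]′ (x∈p∪q⁻ _ _ (subst (x ∈ˢ_) top≡ (x∈p∪q⁺ (inj₂ x∈Y))))

≈ᶜ⇒support-≡ : (B B′ : Cube n) → B ≈ᶜ B′ → Cube.support B ≡ Cube.support B′
≈ᶜ⇒support-≡ B B′ (B⊆B′ , B′⊆B) =
  ⊆-antisym (vertices-⊆⇒support-⊆ B B′ B⊆B′) (vertices-⊆⇒support-⊆ B′ B B′⊆B)

-- The tag is the part of any vertex off the support, so with a common support one shared vertex,
-- here the bottom of `B`, fixes it.
parallel-⊆⇒≈ᶜ : (B B′ : Cube n) → Cube.support B ≡ Cube.support B′ →
                (∀ {c} → vertices B c → vertices B′ c) → B ≈ᶜ B′
parallel-⊆⇒≈ᶜ B B′ refl B⊆B′ = B⊆B′ ,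
  λ { (Z , Z⊆Y , refl) → Z , Z⊆Y , cong (_∪ Z) tags≡ }
  where
  tags≡ : Cube.tag B′ ≡ Cube.tag B
  tags≡ with B⊆B′ (tag-vertex B)
  ... | Z , Z⊆Y , tag≡ = ⊆-antisym
    (λ x∈tag′ → subst (_ ∈ˢ_) (sym tag≡) (x∈p∪q⁺ (inj₁ x∈tag′)))
    (λ x∈tag → [ id , (λ x∈Z → contradiction (Z⊆Y x∈Z) (tag∉support B x∈tag)) ]′
                 (x∈p∪q⁻ _ _ (subst (_ ∈ˢ_) tag≡ x∈tag)))

largest⇒maximal : (C : ConceptClass n) → (∀ Y → Shatters C Y → ∣ Y ∣ ≤ d) →
                  (B : Cube n) → ∣ Cube.support B ∣ ≡ d → IsCubeOf C B → IsMaximalCubeOf C B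
largest⇒maximal C ≤d B refl B⊆C = B⊆C , λ B′ B′⊆C B⊆B′ →
  parallel-⊆⇒≈ᶜ B B′
    (⊆∧∣≥∣⇒≡ (vertices-⊆⇒support-⊆ B B′ B⊆B′) (≤d _ (cube⇒shatters B′ C B′⊆C)))
    B⊆B′

cubeAt : Subset n → Subset n → Cube n
cubeAt c Y = record { support = Y ; tag = c ∩ ∁ Y ; disjoint = p∩q⊆q c (∁ Y) }

∈-cubeAt : (c Y : Subset n) → vertices (cubeAt c Y) c
∈-cubeAt c Y = c ∩ Y , p∩q⊆q c Y , (begin
  c                     ≡⟨ ∩-identityʳ c ⟨
  c ∩ Xˢ                ≡⟨ cong (c ∩_) (trans (∪-comm (∁ Y) Y) (p∪∁p≡⊤ Y)) ⟨
  c ∩ (∁ Y ∪ Y)         ≡⟨ ∩-distribˡ-∪ c (∁ Y) Y ⟩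
  (c ∩ ∁ Y) ∪ (c ∩ Y)   ∎)
  where open ≡-Reasoning

two-cubes⇒¬corner : (C : ConceptClass n) → (∀ Y → Shatters C Y → ∣ Y ∣ ≤ d) →
                    ∀ {c Y₁ Y₂} → Y₁ ≢ Y₂ →
                    ∣ Y₁ ∣ ≡ d → IsCubeOf C (cubeAt c Y₁) →
                    ∣ Y₂ ∣ ≡ d → IsCubeOf C (cubeAt c Y₂) →
                    ¬ IsCorner C c
two-cubes⇒¬corner C ≤d {c} {Y₁} {Y₂} Y₁≢Y₂ ∣Y₁∣ B₁⊆C ∣Y₂∣ B₂⊆C (_ , B , _ , unique) =
  Y₁≢Y₂ (trans (sym (support≡ ∣Y₁∣ B₁⊆C)) (support≡ ∣Y₂∣ B₂⊆C))
  where
  support≡ : ∀ {Y} → ∣ Y ∣ ≡ _ → IsCubeOf C (cubeAt c Y) → Cube.support B ≡ Y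
  support≡ {Y} ∣Y∣ B⊆C = ≈ᶜ⇒support-≡ B (cubeAt c Y)
    (unique {cubeAt c Y} (largest⇒maximal C ≤d (cubeAt c Y) ∣Y∣ B⊆C , ∈-cubeAt c Y))

-- Tries

-- `node A B` consists of the members of A without, and of those of B with, the
-- additional first point.
data Trie : ℕ → Set where
  ∅    : Trie n
  ε    : Trie 0
  node : Trie n → Trie n → Trie (suc n)

infix 4 _∈ᵗ_
data _∈ᵗ_ : Subset n → Trie n → Set where
  nil : [] ∈ᵗ ε
  out : {A B : Trie n} {c : Subset n} → c ∈ᵗ A → outside ∷ c ∈ᵗ node A B
  inn : {A B : Trie n} {c : Subset n} → c ∈ᵗ B → inside  ∷ c ∈ᵗ node A B

-- Tries are not kept reduced: `_∩ᵗ_` may yield a `node` of empty tries.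
isEmpty : Trie n → Bool
isEmpty ∅          = true
isEmpty ε          = false
isEmpty (node A B) = isEmpty A ∧ isEmpty B

branch : Side → Trie (suc n) → Trie n
branch _       ∅          = ∅
branch outside (node A B) = A
branch inside  (node A B) = B

infixr 6 _∪ᵗ_
_∪ᵗ_ : Trie n → Trie n → Trie n
∅        ∪ᵗ U          = U
ε        ∪ᵗ _          = ε
node A B ∪ᵗ ∅          = node A B
node A B ∪ᵗ node A′ B′ = node (A ∪ᵗ A′) (B ∪ᵗ B′)

infixr 7 _∩ᵗ_
_∩ᵗ_ : Trie n → Trie n → Trie n
∅        ∩ᵗ _          = ∅
ε        ∩ᵗ U          = U
node A B ∩ᵗ ∅          = ∅
node A B ∩ᵗ node A′ B′ = node (A ∩ᵗ A′) (B ∩ᵗ B′)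

singleton : Subset n → Trie n
singleton []            = ε
singleton (outside ∷ c) = node (singleton c) ∅
singleton (inside  ∷ c) = node ∅ (singleton c)

fromList : List (Subset n) → Trie n
fromList = foldr (λ c A → singleton c ∪ᵗ A) ∅

elements : Trie n → List (Subset n)
elements ∅          = []
elements ε          = [] ∷ []
elements (node A B) = map (outside ∷_) (elements A) ++ map (inside ∷_) (elements B)

isEmpty⇒∉ : (A : Trie n) → T (isEmpty A) → ∀ {c} → ¬ c ∈ᵗ A
isEmpty⇒∉ (node A B) e (out c∈A) = isEmpty⇒∉ A (proj₁ (Equivalence.to T-∧ e)) c∈A
isEmpty⇒∉ (node A B) e (inn c∈B) = isEmpty⇒∉ B (proj₂ (Equivalence.to (T-∧ {isEmpty A}) e)) c∈B

∈-branch⁺ : ∀ {s} {c : Subset n} {A} → s ∷ c ∈ᵗ A → c ∈ᵗ branch s A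
∈-branch⁺ (out c∈A) = c∈A
∈-branch⁺ (inn c∈B) = c∈B

∈-branch⁻ : ∀ s {c : Subset n} A → c ∈ᵗ branch s A → s ∷ c ∈ᵗ A
∈-branch⁻ outside (node A B) = out
∈-branch⁻ inside  (node A B) = inn

∈-∪ᵗ⁺ : (A B : Trie n) → ∀ {c} → c ∈ᵗ A ⊎ c ∈ᵗ B → c ∈ᵗ A ∪ᵗ B
∈-∪ᵗ⁺ ∅          B            (inj₂ c∈B)       = c∈B
∈-∪ᵗ⁺ ε          B            (inj₁ c∈A)       = c∈A
∈-∪ᵗ⁺ ε          ε            (inj₂ nil)       = nil
∈-∪ᵗ⁺ (node A B) ∅            (inj₁ c∈)        = c∈
∈-∪ᵗ⁺ (node A B) (node A′ B′) (inj₁ (out c∈A)) = out (∈-∪ᵗ⁺ A A′ (inj₁ c∈A))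
∈-∪ᵗ⁺ (node A B) (node A′ B′) (inj₁ (inn c∈B)) = inn (∈-∪ᵗ⁺ B B′ (inj₁ c∈B))
∈-∪ᵗ⁺ (node A B) (node A′ B′) (inj₂ (out c∈A)) = out (∈-∪ᵗ⁺ A A′ (inj₂ c∈A))
∈-∪ᵗ⁺ (node A B) (node A′ B′) (inj₂ (inn c∈B)) = inn (∈-∪ᵗ⁺ B B′ (inj₂ c∈B))

∈-∩ᵗ⁻ : (A B : Trie n) → ∀ {c} → c ∈ᵗ A ∩ᵗ B → c ∈ᵗ A × c ∈ᵗ B
∈-∩ᵗ⁻ ε          ε            nil       = nil , nil
∈-∩ᵗ⁻ (node A B) (node A′ B′) (out c∈) = let c∈A , c∈A′ = ∈-∩ᵗ⁻ A A′ c∈ in out c∈A , out c∈A′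
∈-∩ᵗ⁻ (node A B) (node A′ B′) (inn c∈) = let c∈B , c∈B′ = ∈-∩ᵗ⁻ B B′ c∈ in inn c∈B , inn c∈B′

∈-elements⁺ : {A : Trie n} {c : Subset n} → c ∈ᵗ A → c ∈ elements A
∈-elements⁺ nil       = here refl
∈-elements⁺ (out c∈A) = ∈-++⁺ˡ (∈-map⁺ _ (∈-elements⁺ c∈A))
∈-elements⁺ (inn c∈B) = ∈-++⁺ʳ _ (∈-map⁺ _ (∈-elements⁺ c∈B))

∈-elements⁻ : (A : Trie n) → ∀ {c} → c ∈ elements A → c ∈ᵗ A
∈-elements⁻ ε          (here refl) = nil
∈-elements⁻ (node A B) c∈ with ∈-++⁻ (map (outside ∷_) (elements A)) c∈
... | inj₁ c∈A with _ , c′∈ , refl ← ∈-map⁻ _ c∈A = out (∈-elements⁻ A c′∈)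
... | inj₂ c∈B with _ , c′∈ , refl ← ∈-map⁻ _ c∈B = inn (∈-elements⁻ B c′∈)

-- Distinct paths of a trie spell distinct subsets, so no two concepts have to be compared by
-- computation.
elements-unique : (A : Trie n) → Unique (elements A)
elements-unique ∅          = []
elements-unique ε          = [] ∷ []
elements-unique (node A B) = Unique.++⁺
  (Unique.map⁺ ∷-injectiveʳ (elements-unique A))
  (Unique.map⁺ ∷-injectiveʳ (elements-unique B))
  disjoint
  where
  disjoint : ∀ {c} →
             ¬ (c ∈ map (outside ∷_) (elements A) × c ∈ map (inside ∷_) (elements B))
  disjoint (c∈A , c∈B) with ∈-map⁻ _ c∈A | ∈-map⁻ _ c∈B
  ... | _ , _ , refl | _ , _ , ()

classOf : Trie n → ConceptClass n
classOf A = record { concepts = elements A ; unique = elements-unique A }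

-- Bounding the VC-dimension

infix 4 _shatters_
_shatters_ : Trie n → Subset n → Set
A shatters Y = ∀ {Z} → Z ⊆ˢ Y → ∃ λ c → c ∈ᵗ A × Z ≡ c ∩ Y

-- The trace may be prescribed to have side `s` at the first point, and only members of `branch s A`
-- realise such a trace.
shatters-branch : ∀ s {A : Trie (suc n)} {Y} → A shatters inside ∷ Y → branch s A shatters Y
shatters-branch s {Y = Y} sh {Z} Z⊆Y with sh {s ∷ Z} (lift s)
  where
  lift : ∀ s → s ∷ Z ⊆ˢ inside ∷ Y
  lift outside = out⊆ Z⊆Y
  lift inside  = in⊆in Z⊆Y
... | outside ∷ c , c∈A , refl = c , ∈-branch⁺ c∈A , refl
... | inside  ∷ c , c∈A , refl = c , ∈-branch⁺ c∈A , refl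

-- Forgetting the first point, which lies outside the shattered set, turns `A` into the union of its
-- branches.
shatters-merge : {A : Trie (suc n)} {Y : Subset n} → A shatters outside ∷ Y →
                 branch outside A ∪ᵗ branch inside A shatters Y
shatters-merge {A = A} sh Z⊆Y with sh (s⊆s Z⊆Y)
... | outside ∷ c , c∈A , refl = c , ∈-∪ᵗ⁺ (branch outside A) _ (inj₁ (∈-branch⁺ c∈A)) , refl
... | inside  ∷ c , c∈A , refl = c , ∈-∪ᵗ⁺ (branch outside A) _ (inj₂ (∈-branch⁺ c∈A)) , refl

-- Decides that no set of at least k points is shattered by all the given tries.
-- A set containing the first point is shattered by A iff its other points are
-- shattered by both branches of A, whence the lists.
noneShattered : (n k : ℕ) → List (Trie n) → Bool
-- With no size left to reach, the empty set is a candidate, and only an empty trie fails to shatter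
-- it.
noneShattered n       zero    As = any isEmpty As
noneShattered zero    (suc k) As = true
-- An empty trie shatters nothing, so the search can stop early.
noneShattered (suc n) (suc k) As = any isEmpty As ∨
  (noneShattered n k (concatMap (λ A → branch outside A ∷ branch inside A ∷ []) As) ∧
   noneShattered n (suc k) (map (λ A → branch outside A ∪ᵗ branch inside A) As))

some-empty⇒¬shattered : {As : List (Trie n)} {Y : Subset n} →
                        T (any isEmpty As) → ¬ All (_shatters Y) As
some-empty⇒¬shattered {As = As} {Y} e shs
  with sh , e′ ← All.lookupAny shs (any⁻ isEmpty As e)
  with _ , c∈A , _ ← sh (⊆-min Y) = isEmpty⇒∉ _ e′ c∈A

noneShattered-sound : ∀ k {As : List (Trie n)} → T (noneShattered n k As) →
                      ∀ Y → All (_shatters Y) As → ∣ Y ∣ < k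
noneShattered-sound         zero    e Y  shs = ⊥-elim (some-empty⇒¬shattered e shs)
noneShattered-sound {zero}  (suc k) _ [] shs = s≤s z≤n
noneShattered-sound {suc n} (suc k) {As} e (s ∷ Y) shs
  with Equivalence.to (T-∨ {any isEmpty As}) e
... | inj₁ e₀ = ⊥-elim (some-empty⇒¬shattered e₀ shs)
... | inj₂ e₁ with s | Equivalence.to (T-∧ {noneShattered n k _}) e₁
...   | outside | _ , e-out = noneShattered-sound (suc k) e-out Y
        (All.map⁺ (All.map shatters-merge shs))
...   | inside  | e-in , _  = s≤s $ noneShattered-sound k e-in Y
        (All.concat⁺ (All.map⁺ (All.map
          (λ sh → shatters-branch outside sh ∷ shatters-branch inside sh ∷ []) shs)))

shattered⇒small : (A : Trie n) → T (noneShattered n (suc d) (A ∷ [])) →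
                  ∀ Y → Shatters (classOf A) Y → ∣ Y ∣ ≤ d
shattered⇒small {d = d} A none Y (_ , sh) = s≤s⁻¹ $ noneShattered-sound (suc d) none Y $
  (λ Z⊆Y → let c , c∈ , Z≡ = sh Z⊆Y in c , ∈-elements⁻ A c∈ , Z≡) ∷ []

-- Enumerating the cubes at a concept

-- The supports of size k of the cubes of A at c.  A cube at s ∷ c whose support
-- contains the first point is a cube at c of both branches.
supports : ℕ → Trie n → Subset n → Trie n
supports k       ∅          c       = ∅
supports zero    ε          c       = ε
supports (suc k) ε          c       = ∅
supports zero    (node A B) (s ∷ c) = node (supports zero (branch s (node A B)) c) ∅
supports (suc k) (node A B) (s ∷ c) =
  node (supports (suc k) (branch s (node A B)) c) (supports k (A ∩ᵗ B) c)

∣supports∣ : ∀ k (A : Trie n) c {Y} → Y ∈ᵗ supports k A c → ∣ Y ∣ ≡ k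
∣supports∣ zero    ε          c       nil      = refl
∣supports∣ zero    (node A B) (s ∷ c) (out Y∈) = ∣supports∣ zero (branch s (node A B)) c Y∈
∣supports∣ (suc k) (node A B) (s ∷ c) (out Y∈) = ∣supports∣ (suc k) (branch s (node A B)) c Y∈
∣supports∣ (suc k) (node A B) (s ∷ c) (inn Y∈) = cong suc (∣supports∣ k (A ∩ᵗ B) c Y∈)

-- The first coordinate is that of `(c ∩ ∁ Y) ∪ Z` when the first point is in neither `Y` nor `Z`.
off-support : ∀ s {A : Trie (suc n)} {c} → c ∈ᵗ branch s A → ((s ∧ true) ∨ outside) ∷ c ∈ᵗ A
off-support outside = ∈-branch⁻ outside _
off-support inside  = ∈-branch⁻ inside _

-- For a first point in `Y` the same coordinate reduces to `z`, so membership in both branches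
-- covers either value.
on-support : ∀ s z {A B : Trie n} {c} → c ∈ᵗ A × c ∈ᵗ B → ((s ∧ false) ∨ z) ∷ c ∈ᵗ node A B
on-support outside outside = out ∘ proj₁
on-support outside inside  = inn ∘ proj₂
on-support inside  outside = out ∘ proj₁
on-support inside  inside  = inn ∘ proj₂

supports-cube : ∀ k (A : Trie n) c {Y} → Y ∈ᵗ supports k A c →
                ∀ {Z} → Z ⊆ˢ Y → (c ∩ ∁ Y) ∪ Z ∈ᵗ A
supports-cube zero ε [] nil {[]} Z⊆Y = nil
supports-cube zero (node A B) (s ∷ c) (out Y∈) {inside ∷ Z} Z⊆Y with () ← Z⊆Y here
supports-cube zero (node A B) (s ∷ c) (out Y∈) {outside ∷ Z} Z⊆Y =
  off-support s (supports-cube zero (branch s (node A B)) c Y∈ (drop-∷-⊆ Z⊆Y))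
supports-cube (suc k) (node A B) (s ∷ c) (out Y∈) {inside ∷ Z} Z⊆Y with () ← Z⊆Y here
supports-cube (suc k) (node A B) (s ∷ c) (out Y∈) {outside ∷ Z} Z⊆Y =
  off-support s (supports-cube (suc k) (branch s (node A B)) c Y∈ (drop-∷-⊆ Z⊆Y))
supports-cube (suc k) (node A B) (s ∷ c) (inn Y∈) {z ∷ Z} Z⊆Y =
  on-support s z (∈-∩ᵗ⁻ A B (supports-cube k (A ∩ᵗ B) c Y∈ (drop-∷-⊆ Z⊆Y)))

supports⇒cubeAt : (A : Trie n) {c Y : Subset n} → Y ∈ elements (supports k A c) →
                  ∣ Y ∣ ≡ k × IsCubeOf (classOf A) (cubeAt c Y)
supports⇒cubeAt {k = k} A {c} Y∈ =
  ∣supports∣ k A c Y∈ᵗ ,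
  λ { (Z , Z⊆Y , refl) → ∈-elements⁺ (supports-cube k A c Y∈ᵗ Z⊆Y) }
  where Y∈ᵗ = ∈-elements⁻ (supports k A c) Y∈

nonempty : {X : Set} {xs : List X} → 1 ≤ length xs → ∃ λ x → x ∈ xs
nonempty {xs = x ∷ _} _ = x , here refl

two-distinct : {X : Set} {xs : List X} → Unique xs → 2 ≤ length xs →
               ∃₂ λ x y → x ≢ y × x ∈ xs × y ∈ xs
two-distinct {xs = _ ∷ []} _ (s≤s ())
two-distinct {xs = x ∷ y ∷ _} ((x≢y ∷ _) ∷ _) _ = x , y , x≢y , here refl , there (here refl)

two-supports⇒¬corner : (A : Trie n) → T (noneShattered n (suc d) (A ∷ [])) →
                       All (λ c → 2 ≤ length (elements (supports d A c))) (elements A) →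
                       ¬ ∃ λ c → IsCorner (classOf A) c
two-supports⇒¬corner {d = d} A none two (c , corner@(c∈A , _)) =
  let Y₁ , Y₂ , Y₁≢Y₂ , Y₁∈ , Y₂∈ =
        two-distinct (elements-unique (supports d A c)) (All.lookup two c∈A)
      ∣Y₁∣ , B₁⊆A = supports⇒cubeAt A Y₁∈
      ∣Y₂∣ , B₂⊆A = supports⇒cubeAt A Y₂∈
  in two-cubes⇒¬corner (classOf A) (shattered⇒small A none) Y₁≢Y₂ ∣Y₁∣ B₁⊆A ∣Y₂∣ B₂⊆A corner

-- The support of a single `d`-cube is a shattered set of size `d`, which gives the lower bound.
hasVCDim : (A : Trie n) → T (noneShattered n (suc d) (A ∷ [])) →
           ∀ {c} → 1 ≤ length (elements (supports d A c)) → HasVCDim (classOf A) d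
hasVCDim {d = d} A none {c} one =
  let Y , Y∈ = nonempty one
      ∣Y∣ , B⊆A = supports⇒cubeAt A Y∈
  in (Y , cube⇒shatters (cubeAt c Y) (classOf A) B⊆A , ∣Y∣) , shattered⇒small A none

-- The class without corners

fromBits : (n : ℕ) → ℕ → Subset n
fromBits zero    m = []
fromBits (suc n) m = (m % 2 ≡ᵇ 1) ∷ fromBits n (m / 2)

rotations : ℕ → List ℕ
rotations m = m ∷ rotate m ∷ rotate (rotate m) ∷ []
  where
  rotate : ℕ → ℕ
  -- The lowest hexadecimal digit becomes the highest, a cyclic shift of the twelve points by four
  -- places.
  rotate m = m / 16 + m % 16 * 256

-- One concept from each orbit under the rotations of the three hexadecimal digits.
-- The concepts are the regions of an arrangement of twelve pseudoplanes in a
-- 3-ball with a threefold symmetry, and the 3-cubes correspond to its 220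
-- vertices; a corner would be a region with a single vertex.  The arrangement was
-- found by simulated annealing, starting from twelve planes and flipping simplices
-- (also across infinity) so as to minimise the number of such regions.
orbits : List ℕ
orbits =
  0x000 ∷ 0x001 ∷ 0x002 ∷ 0x003 ∷ 0x004 ∷ 0x005 ∷ 0x006 ∷ 0x007 ∷ 0x00b ∷ 0x00f ∷ 0x011 ∷
  0x013 ∷ 0x017 ∷ 0x01b ∷ 0x01f ∷ 0x021 ∷ 0x023 ∷ 0x024 ∷ 0x025 ∷ 0x026 ∷ 0x027 ∷ 0x02f ∷
  0x031 ∷ 0x033 ∷ 0x034 ∷ 0x035 ∷ 0x036 ∷ 0x037 ∷ 0x03b ∷ 0x03f ∷ 0x044 ∷ 0x046 ∷ 0x064 ∷
  0x066 ∷ 0x074 ∷ 0x0a4 ∷ 0x0a6 ∷ 0x0a7 ∷ 0x0ae ∷ 0x0af ∷ 0x0b1 ∷ 0x0b3 ∷ 0x0b4 ∷ 0x0b5 ∷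
  0x0b6 ∷ 0x0b7 ∷ 0x0b9 ∷ 0x0bb ∷ 0x0bd ∷ 0x0be ∷ 0x0bf ∷ 0x0e4 ∷ 0x0e6 ∷ 0x0ec ∷ 0x0ee ∷
  0x0f4 ∷ 0x0f5 ∷ 0x0f6 ∷ 0x0f7 ∷ 0x0fc ∷ 0x0fd ∷ 0x0fe ∷ 0x0ff ∷ 0x111 ∷ 0x113 ∷ 0x11b ∷
  0x11f ∷ 0x133 ∷ 0x13b ∷ 0x13f ∷ 0x1b3 ∷ 0x1b4 ∷ 0x1b5 ∷ 0x1b9 ∷ 0x1bb ∷ 0x1bd ∷ 0x1bf ∷
  0x1f4 ∷ 0x1f5 ∷ 0x264 ∷ 0x274 ∷ 0x2e4 ∷ 0x2f4 ∷ 0x444 ∷ 0x446 ∷ 0x44e ∷ 0x466 ∷ 0x46e ∷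
  0x4a6 ∷ 0x4a7 ∷ 0x4ae ∷ 0x4af ∷ 0x4ce ∷ 0x4e6 ∷ 0x4ec ∷ 0x4ee ∷ 0x666 ∷ 0x66e ∷ 0x6ce ∷
  0x6ee ∷ 0xcce ∷ 0xcee ∷ 0xeee ∷ []

-- A concept with three equal digits is produced three times by `rotations`; the union of tries
-- absorbs the copies.
cornerless : Trie 12
cornerless = fromList (map (fromBits 12) (concatMap rotations orbits))

-- By evaluation: the threshold 4 excludes shattered sets of four or more points, and `T true` is
-- the unit type.
cornerless-vc≤3 : T (noneShattered 12 4 (cornerless ∷ []))
cornerless-vc≤3 = _

cornerless-supports :
  All (λ c → 2 ≤ length (elements (supports 3 cornerless c))) (elements cornerless)
cornerless-supports = toWitness
  {a? = all? (λ c → 2 ≤? length (elements (supports 3 cornerless c))) (elements cornerless)} _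

cornerless-vc : HasVCDim (classOf cornerless) 3
-- The empty set is a concept of the class, and its 3-cubes provide the shattered set of size 3.
cornerless-vc = hasVCDim {d = 3} cornerless cornerless-vc≤3 {∅ˢ}
  (toWitness {a? = 1 ≤? length (elements (supports 3 cornerless ∅ˢ))} _)

theorem4p5 : ∃ λ (n : ℕ) → ∃ λ (C : ConceptClass n) →
    IsMaximum C × HasVCDim C 3 × ¬ (∃ λ c → IsCorner C c)
theorem4p5 =
  -- Here `refl` checks that the number of concepts, 299, equals 1 + 12 + 66 + 220.
  12 , classOf cornerless , (3 , cornerless-vc , refl) , cornerless-vc ,
  two-supports⇒¬corner {d = 3} cornerless cornerless-vc≤3 cornerless-supports
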